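{- Let $s,n\ge0$ be integers and $w\in\{\mathtt a,\mathtt b\}^n$. Then the cardinality of the $\approx_s$-class $[w]_s\subseteq\{\mathtt a,\mathtt b\}^n$ of $w$ is the coefficient $$\#[w]_s=[q^{\,R_s(w)}]\binom{(|w|_{\mathtt a}-\ell)+(|w|_{\mathtt b}-\theta)}{|w|_{\mathtt a}-\ell}_{\!q}.$$
   Context: For words $w,v$, $\binom{w}{v}$ is the number of occurrences of $v$ as a scattered subword of $w$; $|w|_{x}$ is the number of letters $x$ in $w$. For $u,w\in\{\mathtt a,\mathtt b\}^n$: $u\sim_2w$ iff $|u|_{\mathtt a}=|w|_{\mathtt a}$ and $\binom{u}{\mathtt{ab}}=\binom{w}{\mathtt{ab}}$. For $w\in\{\mathtt a,\mathtt b\}^n$ let $\lambda(w)=(r_1,\dots,r_{|w|_{\mathtt a}})$ where $r_i$ is the number of $\mathtt b$'s to the right of the $i$-th $\mathtt a$. Let $\ell=\min(s,|w|_{\mathtt a})$; the $s$-tail is $\mathcal T_s(w)=(r_{|w|_{\mathtt a}},\dots,r_{|w|_{\mathtt a}-\ell+1})$ (empty if $\ell=0$). Let $\theta=r_{|w|_{\mathtt a}-\ell+1}$ be its last entry and $|\mathcal T_s(w)|$ the sum of its entries, both $0$ when $\ell=0$. Define $u\approx_sw$ iff $u\sim_2w$ and $\mathcal T_s(u)=\mathcal T_s(w)$. The $s$-residual area is $$R_s(w)=\binom{w}{\mathtt{ab}}-(|w|_{\mathtt a}-\ell)\,\theta-|\mathcal T_s(w)|.$$ The Gaussian binomial coefficient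 is the polynomial $\binom{c}{d}_q=\prod_{i=1}^d\frac{1-q^{c-d+i}}{1-q^i}$ for $0\le d\le c$ (and $0$ otherwise); $[q^k]f$ denotes the coefficient of $q^k$ in $f$. -}

module Defs where

open import Data.Bool.Base using (if_then_else_)
open import Data.Fin.Base using (Fin; zero; suc; toℕ)
open import Data.Integer.Base as ℤ using (ℤ; +_; -[1+_]; 0ℤ; 1ℤ)
import Data.Integer.Properties as ℤ
open import Data.List.Base using (List; []; _∷_; _++_; map; filter; length; take; reverse; last)
open import Data.List.Properties using (≡-dec)
open import Data.List.Relation.Unary.All as All using (All; []; _∷_)
open import Data.List.Relation.Binary.Permutation.Propositional using (↭-sym)
open import Data.List.Relation.Binary.Permutation.Propositional.Properties using (All-resp-↭; ↭-reverse)
import Data.List.Relation.Unary.All.Properties as All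
open import Data.Maybe.Base using (fromMaybe)
open import Data.Nat.Base using (ℕ; zero; suc; _+_; _*_; _∸_; _⊓_; _≤_; _<_; z≤n; s≤s; NonZero)
open import Data.Nat.Divisibility using (_∣_; _∣?_; _∣0; ∣-refl; ∣⇒≤; ∣m∸n∣n⇒∣m; ∣m+n∣m⇒∣n)
open import Data.Nat.ListAction using (sum)
open import Data.Nat.Properties as ℕ using (_≟_; _≤?_)
open import Data.Product.Base using (Σ; _×_)
open import Data.Vec.Base using (Vec; []; _∷_; count; toList)
open import Function.Base using (_∘_)
open import Function.Bundles using (_↔_)
open import Relation.Binary.Definitions using (DecidableEquality)
open import Relation.Binary.PropositionalEquality
open import Relation.Nullary using (¬_; Dec; does; yes; no; contradiction)
open import Relation.Nullary.Decidable using (dec-true; dec-false)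

import Algebra.Properties.Semiring.Sum ℤ.+-*-semiring as ℤSum

data Letter : Set where
  a b : Letter

_≟ᴸ_ : DecidableEquality Letter
a ≟ᴸ a = yes refl
a ≟ᴸ b = no λ ()
b ≟ᴸ a = no λ ()
b ≟ᴸ b = yes refl

Word : ℕ → Set
Word n = Vec Letter n

∣_∣[_] : ∀ {n} → Word n → Letter → ℕ
∣ w ∣[ x ] = count (_≟ᴸ x) w

-- One entry for each set of positions, so subwords are listed with multiplicity.
scatteredSubwords : List Letter → List (List Letter)
scatteredSubwords []      = [] ∷ []
scatteredSubwords (x ∷ w) = map (x ∷_) (scatteredSubwords w) ++ scatteredSubwords w

occurrences : ∀ {n} → Word n → List Letter → ℕ
occurrences w v = length (filter (λ u → ≡-dec _≟ᴸ_ u v) (scatteredSubwords (toList w)))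

ab : List Letter
ab = a ∷ b ∷ []

infix 4 _∼₂_
_∼₂_ : ∀ {n} → Word n → Word n → Set
u ∼₂ w = ∣ u ∣[ a ] ≡ ∣ w ∣[ a ] × occurrences u ab ≡ occurrences w ab

-- (r₁ , … , r_{|w|ₐ}), where rᵢ counts the b's to the right of the i-th a.
bsToRight : ∀ {n} → Word n → List ℕ
bsToRight []      = []
bsToRight (a ∷ w) = ∣ w ∣[ b ] ∷ bsToRight w
bsToRight (b ∷ w) = bsToRight w

tailLength : ∀ {n} → ℕ → Word n → ℕ
tailLength s w = s ⊓ ∣ w ∣[ a ]

tail : ∀ {n} → ℕ → Word n → List ℕ
tail s w = take (tailLength s w) (reverse (bsToRight w))

θ : ∀ {n} → ℕ → Word n → ℕ
θ s w = fromMaybe 0 (last (tail s w))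

-- Hence ∣ w ∣[ b ] ∸ θ s w is never truncated.
θ≤∣w∣b : ∀ {n} s (w : Word n) → θ s w ≤ ∣ w ∣[ b ]
θ≤∣w∣b s w = last≤ (All.take⁺ (tailLength s w) (All-resp-↭ (↭-sym (↭-reverse (bsToRight w))) (entries≤ w)))
  where
  entries≤ : ∀ {n} (w : Word n) → All (_≤ ∣ w ∣[ b ]) (bsToRight w)
  entries≤ []      = []
  entries≤ (a ∷ w) = ℕ.≤-refl ∷ entries≤ w
  entries≤ (b ∷ w) = All.map ℕ.m≤n⇒m≤1+n (entries≤ w)

  last≤ : ∀ {m rs} → All (_≤ m) rs → fromMaybe 0 (last rs) ≤ m
  last≤ []           = z≤n
  last≤ (r≤ ∷ [])    = r≤
  last≤ (_ ∷ p ∷ ps) = last≤ (p ∷ ps)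

infix 4 _≈[_]_
_≈[_]_ : ∀ {n} → Word n → ℕ → Word n → Set
u ≈[ s ] w = u ∼₂ w × tail s u ≡ tail s w

-- The equations involved live in sets, so elements of this type correspond to
-- words in the class without repetition.
Class : ∀ {n} → ℕ → Word n → Set
Class {n} s w = Σ (Word n) λ u → u ≈[ s ] w

HasCardinality : Set → ℕ → Set
HasCardinality X k = X ↔ Fin k

residualArea : ∀ {n} → ℕ → Word n → ℤ
residualArea s w =
  + occurrences w ab
    ℤ.- + ((∣ w ∣[ a ] ∸ tailLength s w) * θ s w)
    ℤ.- + sum (tail s w)

-- Quotients of polynomials whose denominators have constant term 1 are computed
-- in ℤ[[q]], which contains ℤ[q]; a series is its sequence of coefficients.
Series : Set
Series = ℕ → ℤ

infixl 7 _⊛_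
_⊛_ : Series → Series → Series
(f ⊛ g) k = ℤSum.sum {suc k} λ i → f (toℕ i) ℤ.* g (k ∸ toℕ i)

q^ : ℕ → Series
q^ m k = if does (k ≟ m) then 1ℤ else 0ℤ

𝟙 : Series
𝟙 = q^ 0

1-q^ : ℕ → Series
1-q^ m k = 𝟙 k ℤ.- q^ m k

-- Σⱼ q^(i·j)
1/[1-q^_] : (i : ℕ) .{{_ : NonZero i}} → Series
1/[1-q^ i ] k = if does (i ∣? k) then 1ℤ else 0ℤ

-- The product of f 1, …, f d.
∏ : (d : ℕ) → ((i : ℕ) .{{_ : NonZero i}} → Series) → Series
∏ zero    f = 𝟙
∏ (suc d) f = ∏ d f ⊛ f (suc d)

gaussianBinomial : ℕ → ℕ → Series
gaussianBinomial c d =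
  if does (d ≤? c)
  then ∏ d (λ i → 1-q^ (c ∸ d + i) ⊛ 1/[1-q^ i ])
  else λ _ → 0ℤ

[q^_]_ : ℤ → Series → ℤ
[q^ + k      ] f = f k
[q^ -[1+ _ ] ] f = 0ℤ

private
  sum-zero : ∀ n (t : Fin n → ℤ) → (∀ i → t i ≡ 0ℤ) → ℤSum.sum t ≡ 0ℤ
  sum-zero zero    t t≡0 = refl
  sum-zero (suc n) t t≡0 = cong₂ ℤ._+_ (t≡0 zero) (sum-zero n (t ∘ suc) (t≡0 ∘ suc))

  q^-⊛-≤ : ∀ m g k → m ≤ k → (q^ m ⊛ g) k ≡ g (k ∸ m)
  q^-⊛-≤ zero g k _ = trans
    (cong₂ ℤ._+_ (ℤ.*-identityˡ (g k)) (sum-zero k _ λ _ → refl))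
    (ℤ.+-identityʳ (g k))
  q^-⊛-≤ (suc m) g (suc k) (s≤s m≤k) = trans (ℤ.+-identityˡ _) (q^-⊛-≤ m g k m≤k)

  q^-⊛-> : ∀ m g k → k < m → (q^ m ⊛ g) k ≡ 0ℤ
  q^-⊛-> (suc m) g zero    _         = refl
  q^-⊛-> (suc m) g (suc k) (s≤s k<m) = trans (ℤ.+-identityˡ _) (q^-⊛-> m g k k<m)

  sum-neg : ∀ n (t : Fin n → ℤ) → ℤSum.sum (ℤ.-_ ∘ t) ≡ ℤ.- ℤSum.sum t
  sum-neg zero    t = refl
  sum-neg (suc n) t = trans
    (cong (λ z → ℤ.- t zero ℤ.+ z) (sum-neg n (t ∘ suc)))
    (sym (ℤ.neg-distrib-+ (t zero) _))

  1-q^-⊛ : ∀ m g k → (1-q^ m ⊛ g) k ≡ g k ℤ.- (q^ m ⊛ g) k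
  1-q^-⊛ m g k = begin
    (1-q^ m ⊛ g) k
      ≡⟨ ℤSum.sum-cong-≗ (λ i → trans
           (ℤ.*-distribʳ-+ (h i) (𝟙 (toℕ i)) (ℤ.- q^ m (toℕ i)))
           (cong (λ z → 𝟙 (toℕ i) ℤ.* h i ℤ.+ z)
             (sym (ℤ.neg-distribˡ-* (q^ m (toℕ i)) (h i))))) ⟩
    ℤSum.sum (λ i → 𝟙 (toℕ i) ℤ.* h i ℤ.+ ℤ.- (q^ m (toℕ i) ℤ.* h i))
      ≡⟨ ℤSum.∑-distrib-+ (λ i → 𝟙 (toℕ i) ℤ.* h i) (λ i → ℤ.- (q^ m (toℕ i) ℤ.* h i)) ⟩
    (𝟙 ⊛ g) k ℤ.+ ℤSum.sum (λ i → ℤ.- (q^ m (toℕ i) ℤ.* h i))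
      ≡⟨ cong₂ ℤ._+_ (q^-⊛-≤ 0 g k z≤n) (sum-neg (suc k) (λ i → q^ m (toℕ i) ℤ.* h i)) ⟩
    g k ℤ.- (q^ m ⊛ g) k ∎
    where
    open ≡-Reasoning
    h : Fin (suc k) → ℤ
    h i = g (k ∸ toℕ i)

  1/[1-q^]-∣ : ∀ i .{{_ : NonZero i}} {k} → i ∣ k → 1/[1-q^ i ] k ≡ 1ℤ
  1/[1-q^]-∣ i {k} i∣k = cong (if_then 1ℤ else 0ℤ) (dec-true (i ∣? k) i∣k)

  1/[1-q^]-∤ : ∀ i .{{_ : NonZero i}} {k} → ¬ i ∣ k → 1/[1-q^ i ] k ≡ 0ℤ
  1/[1-q^]-∤ i {k} i∤k = cong (if_then 1ℤ else 0ℤ) (dec-false (i ∣? k) i∤k)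

1/[1-q^]-inverse : ∀ i .{{_ : NonZero i}} k → (1-q^ i ⊛ 1/[1-q^ i ]) k ≡ 𝟙 k
1/[1-q^]-inverse i@(suc _) k = trans (1-q^-⊛ i 1/[1-q^ i ] k) (step k (i ≤? k) (i ∣? k))
  where
  step : ∀ k → Dec (i ≤ k) → Dec (i ∣ k) →
         1/[1-q^ i ] k ℤ.- (q^ i ⊛ 1/[1-q^ i ]) k ≡ 𝟙 k
  step k@(suc _) (yes i≤k) (yes i∣k) = cong₂ ℤ._-_ (1/[1-q^]-∣ i i∣k)
    (trans (q^-⊛-≤ i 1/[1-q^ i ] k i≤k)
      (1/[1-q^]-∣ i (∣m+n∣m⇒∣n (subst (i ∣_) (sym (ℕ.m+[n∸m]≡n i≤k)) i∣k) ∣-refl)))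
  step k@(suc _) (yes i≤k) (no i∤k) = cong₂ ℤ._-_ (1/[1-q^]-∤ i i∤k)
    (trans (q^-⊛-≤ i 1/[1-q^ i ] k i≤k)
      (1/[1-q^]-∤ i λ i∣ → i∤k (∣m∸n∣n⇒∣m i i≤k i∣ ∣-refl)))
  step zero      _         (no i∤0)  = contradiction (i ∣0) i∤0
  step zero      (no i≰0)  (yes i∣0) = cong₂ ℤ._-_ (1/[1-q^]-∣ i i∣0)
    (q^-⊛-> i 1/[1-q^ i ] 0 (ℕ.≰⇒> i≰0))
  step (suc _)   (no i≰k)  (yes i∣k) = contradiction (∣⇒≤ i∣k) i≰k
  step k@(suc _) (no i≰k)  (no i∤k)  = cong₂ ℤ._-_ (1/[1-q^]-∤ i i∤k)
    (q^-⊛-> i 1/[1-q^ i ] k (ℕ.≰⇒> i≰k))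

{-# OPTIONS --safe #-}

-- Cut w before its ℓ-th a from the right (nowhere if ℓ = 0): w = x ++ v. The
-- tail determines v, so the words of the class are exactly the y ++ v where y
-- has as many a's, as many b's and as many occurrences of ab as x, and the
-- residual area of w is the number of occurrences of ab in x. Splitting off the
-- first letter, the words of length m with d a's, counted by the occurrences of
-- ab, satisfy q-Pascal's rule
--   [m+1 , d+1] = q^(m-d) [m , d] + [m , d+1].
module Submission where

open import Defs
open import Algebra.Bundles using (CommutativeSemigroup)
import Algebra.Properties.CommutativeSemigroup as CommutativeSemigroupProperties
open import Data.Bool.Base using (if_then_else_)
open import Data.Empty using (⊥-elim)
open import Data.Fin.Base using (zero)
open import Data.Fin.Properties using (+↔⊎)
open import Data.Integer.Base as ℤ using (ℤ; +_; 0ℤ)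
import Data.Integer.Properties as ℤ
open import Data.Integer.Tactic.RingSolver using (solve-∀)
open import Data.List.Base as List using (List; []; _∷_; length; map; filter; reverse; last; take; drop)
open import Data.List.Properties as List using (≡-dec; filter-++; length-++; unfold-reverse)
open import Data.List.Relation.Binary.Permutation.Propositional.Properties using (↭-reverse)
open import Data.Maybe.Base using (just; fromMaybe)
open import Data.Nat.Base using (ℕ; zero; suc; _+_; _*_; _∸_; _⊓_; _≤_; _<_; z≤n; s≤s; NonZero)
open import Data.Nat.ListAction using (sum)
open import Data.Nat.ListAction.Properties using (sum-↭)
open import Data.Nat.Properties as ℕ using (_≤?_)
open import Data.Product.Base using (Σ; ∃-syntax; _×_; _,_)
open import Data.Sum.Base using (_⊎_; inj₁; inj₂)
open import Data.Sum.Function.Propositional using (_⊎-cong_)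
open import Data.Vec.Base as Vec using (Vec; []; _∷_; _++_; toList; fromList)
import Data.Vec.Properties as Vec
open import Function.Base using (_∘_; id)
open import Function.Bundles using (_↔_; mk↔ₛ′)
open import Function.Construct.Composition using (_↔-∘_)
open import Function.Construct.Symmetry using (↔-sym)
open import Function.Definitions using (Injective)
open import Relation.Binary.PropositionalEquality
open import Relation.Binary.PropositionalEquality.WithK using (≡-irrelevant)
import Relation.Binary.Reasoning.Setoid as SetoidReasoning
open import Relation.Nullary using (¬_; yes; no)
open import Relation.Nullary.Decidable using (dec-true; dec-false)
open import Relation.Unary using (Irrelevant)

-- Power series as a commutative ring under convolution.

𝟘 : Series
𝟘 _ = 0ℤ

infixl 6 _⊕_
_⊕_ : Series → Series → Series
(f ⊕ g) k = f k ℤ.+ g k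

infixr 7 _·_
_·_ : ℤ → Series → Series
(c · f) k = c ℤ.* f k

-- Splitting off the first summand, `(f ⊛ g) (suc k)` computes to
-- `f 0 ℤ.* g (suc k) ℤ.+ (shift f ⊛ g) k`. The convolution laws therefore go by induction on the
-- index, with the series generalised.
shift : Series → Series
shift f = f ∘ suc

⊛-cong : ∀ {f f′ g g′} → f ≗ f′ → g ≗ g′ → f ⊛ g ≗ f′ ⊛ g′
⊛-cong f≗f′ g≗g′ zero    = cong (ℤ._+ 0ℤ) (cong₂ ℤ._*_ (f≗f′ 0) (g≗g′ 0))
⊛-cong f≗f′ g≗g′ (suc k) =
  cong₂ ℤ._+_ (cong₂ ℤ._*_ (f≗f′ 0) (g≗g′ (suc k))) (⊛-cong (f≗f′ ∘ suc) g≗g′ k)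

⊛-distribʳ-⊕ : ∀ h f g → (f ⊕ g) ⊛ h ≗ f ⊛ h ⊕ g ⊛ h
⊛-distribʳ-⊕ h f g zero    = lemma (f 0) (g 0) (h 0)
  where
  lemma : ∀ x y z → (x ℤ.+ y) ℤ.* z ℤ.+ 0ℤ ≡ (x ℤ.* z ℤ.+ 0ℤ) ℤ.+ (y ℤ.* z ℤ.+ 0ℤ)
  lemma = solve-∀
⊛-distribʳ-⊕ h f g (suc k) = trans
  (cong (λ z → (f 0 ℤ.+ g 0) ℤ.* h (suc k) ℤ.+ z) (⊛-distribʳ-⊕ h (shift f) (shift g) k))
  (lemma (f 0) (g 0) (h (suc k)) ((shift f ⊛ h) k) ((shift g ⊛ h) k))
  where
  lemma : ∀ x y z u v →
    (x ℤ.+ y) ℤ.* z ℤ.+ (u ℤ.+ v) ≡ (x ℤ.* z ℤ.+ u) ℤ.+ (y ℤ.* z ℤ.+ v)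
  lemma = solve-∀

·-⊛-assoc : ∀ c f g → (c · f) ⊛ g ≗ c · (f ⊛ g)
·-⊛-assoc c f g zero    = lemma c (f 0) (g 0)
  where
  lemma : ∀ x y z → (x ℤ.* y) ℤ.* z ℤ.+ 0ℤ ≡ x ℤ.* (y ℤ.* z ℤ.+ 0ℤ)
  lemma = solve-∀
·-⊛-assoc c f g (suc k) = trans
  (cong (λ z → c ℤ.* f 0 ℤ.* g (suc k) ℤ.+ z) (·-⊛-assoc c (shift f) g k))
  (lemma c (f 0) (g (suc k)) ((shift f ⊛ g) k))
  where
  lemma : ∀ x y z u → (x ℤ.* y) ℤ.* z ℤ.+ x ℤ.* u ≡ x ℤ.* (y ℤ.* z ℤ.+ u)
  lemma = solve-∀

⊛-assoc : ∀ f g h → (f ⊛ g) ⊛ h ≗ f ⊛ (g ⊛ h)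
⊛-assoc f g h zero    = lemma (f 0) (g 0) (h 0)
  where
  lemma : ∀ x y z → (x ℤ.* y ℤ.+ 0ℤ) ℤ.* z ℤ.+ 0ℤ ≡ x ℤ.* (y ℤ.* z ℤ.+ 0ℤ) ℤ.+ 0ℤ
  lemma = solve-∀
⊛-assoc f g h (suc k) = begin
  -- The series `shift (f ⊛ g)` unfolds to `f 0 · shift g ⊕ shift f ⊛ g`, which is linear in
  -- products to which the induction hypothesis or `·-⊛-assoc` applies.
  (f 0 ℤ.* g 0 ℤ.+ 0ℤ) ℤ.* h (suc k) ℤ.+ ((f 0 · shift g ⊕ shift f ⊛ g) ⊛ h) k
    ≡⟨ cong (λ z → (f 0 ℤ.* g 0 ℤ.+ 0ℤ) ℤ.* h (suc k) ℤ.+ z)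
         (trans (⊛-distribʳ-⊕ h (f 0 · shift g) (shift f ⊛ g) k)
                (cong₂ ℤ._+_ (·-⊛-assoc (f 0) (shift g) h k) (⊛-assoc (shift f) g h k))) ⟩
  (f 0 ℤ.* g 0 ℤ.+ 0ℤ) ℤ.* h (suc k) ℤ.+ (f 0 ℤ.* (shift g ⊛ h) k ℤ.+ (shift f ⊛ (g ⊛ h)) k)
    ≡⟨ lemma (f 0) (g 0) (h (suc k)) ((shift g ⊛ h) k) ((shift f ⊛ (g ⊛ h)) k) ⟩
  f 0 ℤ.* (g 0 ℤ.* h (suc k) ℤ.+ (shift g ⊛ h) k) ℤ.+ (shift f ⊛ (g ⊛ h)) k ∎
  where
  open ≡-Reasoning
  lemma : ∀ x y z u v →
    (x ℤ.* y ℤ.+ 0ℤ) ℤ.* z ℤ.+ (x ℤ.* u ℤ.+ v) ≡ x ℤ.* (y ℤ.* z ℤ.+ u) ℤ.+ v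
  lemma = solve-∀

-- The mirror image of the defining recursion: the last summand is split off instead of the first.
-- Commutativity compares the two.
⊛-suc : ∀ f g k → (f ⊛ g) (suc k) ≡ f (suc k) ℤ.* g 0 ℤ.+ (f ⊛ shift g) k
⊛-suc f g zero    = lemma (f 0 ℤ.* g 1) (f 1 ℤ.* g 0)
  where
  lemma : ∀ x y → x ℤ.+ (y ℤ.+ 0ℤ) ≡ y ℤ.+ (x ℤ.+ 0ℤ)
  lemma = solve-∀
⊛-suc f g (suc k) = trans
  (cong (λ z → f 0 ℤ.* g (2 + k) ℤ.+ z) (⊛-suc (shift f) g k))
  (lemma (f 0 ℤ.* g (2 + k)) (f (2 + k) ℤ.* g 0) ((shift f ⊛ shift g) k))
  where
  lemma : ∀ x y z → x ℤ.+ (y ℤ.+ z) ≡ y ℤ.+ (x ℤ.+ z)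
  lemma = solve-∀

⊛-comm : ∀ f g → f ⊛ g ≗ g ⊛ f
⊛-comm f g zero    = cong (ℤ._+ 0ℤ) (ℤ.*-comm (f 0) (g 0))
⊛-comm f g (suc k) = trans (⊛-suc f g k)
  (cong₂ ℤ._+_ (ℤ.*-comm (f (suc k)) (g 0)) (⊛-comm f (shift g) k))

⊛-zeroʳ : ∀ f → f ⊛ 𝟘 ≗ 𝟘
⊛-zeroʳ f zero    = cong (ℤ._+ 0ℤ) (ℤ.*-zeroʳ (f 0))
⊛-zeroʳ f (suc k) = cong₂ ℤ._+_ (ℤ.*-zeroʳ (f 0)) (⊛-zeroʳ (shift f) k)

⊛-zeroˡ : ∀ f → 𝟘 ⊛ f ≗ 𝟘
⊛-zeroˡ f k = trans (⊛-comm 𝟘 f k) (⊛-zeroʳ f k)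

⊛-identityˡ : ∀ f → 𝟙 ⊛ f ≗ f
⊛-identityˡ f zero    = trans (ℤ.+-identityʳ _) (ℤ.*-identityˡ (f 0))
⊛-identityˡ f (suc k) = trans
  (cong₂ ℤ._+_ (ℤ.*-identityˡ (f (suc k))) (⊛-zeroˡ f k)) (ℤ.+-identityʳ _)

⊛-identityʳ : ∀ f → f ⊛ 𝟙 ≗ f
⊛-identityʳ f k = trans (⊛-comm f 𝟙 k) (⊛-identityˡ f k)

⊛-distribˡ-⊕ : ∀ f g h → f ⊛ (g ⊕ h) ≗ f ⊛ g ⊕ f ⊛ h
⊛-distribˡ-⊕ f g h k = trans (⊛-comm f (g ⊕ h) k)
  (trans (⊛-distribʳ-⊕ f g h k) (cong₂ ℤ._+_ (⊛-comm g f k) (⊛-comm h f k)))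

⊛-commutativeSemigroup : CommutativeSemigroup _ _
⊛-commutativeSemigroup = record
  { Carrier = Series
  ; _≈_     = _≗_
  ; _∙_     = _⊛_
  ; isCommutativeSemigroup = record
    { isSemigroup = record
      { isMagma = record
        { isEquivalence = record
          { refl  = λ _ → refl
          ; sym   = λ f≗g k → sym (f≗g k)
          ; trans = λ f≗g g≗h k → trans (f≗g k) (g≗h k)
          }
        ; ∙-cong = ⊛-cong
        }
      ; assoc = ⊛-assoc
      }
    ; comm = ⊛-comm
    }
  }

open CommutativeSemigroup ⊛-commutativeSemigroup using ()
  renaming (setoid to seriesSetoid; ∙-congˡ to ⊛-congˡ; ∙-congʳ to ⊛-congʳ)
open CommutativeSemigroupProperties ⊛-commutativeSemigroup
  using (xy∙z≈xz∙y; x∙yz≈xy∙z)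
open CommutativeSemigroupProperties ℕ.+-commutativeSemigroup using ()
  renaming (interchange to ℕ+-interchange)
module ≗-Reasoning = SetoidReasoning seriesSetoid

-- Monomials, Gaussian products and q-Pascal's rule.

q^-⊛-≤ : ∀ {m k} f → m ≤ k → (q^ m ⊛ f) k ≡ f (k ∸ m)
q^-⊛-≤ {k = k} f z≤n = ⊛-identityˡ f k
q^-⊛-≤ f (s≤s m≤k)   = trans (ℤ.+-identityˡ _) (q^-⊛-≤ f m≤k)

q^-⊛-> : ∀ {m k} f → k < m → (q^ m ⊛ f) k ≡ 0ℤ
q^-⊛-> {k = zero}  f (s≤s _)   = refl
q^-⊛-> {k = suc _} f (s≤s k<m) = trans (ℤ.+-identityˡ _) (q^-⊛-> f k<m)

q^-⊛-1-q^ : ∀ m i k → (q^ m ⊛ 1-q^ i) k ≡ q^ m k ℤ.- q^ (m + i) k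
q^-⊛-1-q^ zero    i k       = ⊛-identityˡ (1-q^ i) k
q^-⊛-1-q^ (suc m) i zero    = refl
q^-⊛-1-q^ (suc m) i (suc k) = trans (ℤ.+-identityˡ _) (q^-⊛-1-q^ m i k)

1-q^-+ : ∀ m i → 1-q^ (m + i) ≗ q^ m ⊛ 1-q^ i ⊕ 1-q^ m
1-q^-+ m i k = trans (lemma (𝟙 k) (q^ m k) (q^ (m + i) k))
  (cong (ℤ._+ 1-q^ m k) (sym (q^-⊛-1-q^ m i k)))
  where
  lemma : ∀ x y z → x ℤ.- z ≡ (y ℤ.- z) ℤ.+ (x ℤ.- y)
  lemma = solve-∀

-- The source of q-Pascal's rule: in 1 - q^(m+i) = q^m (1 - q^i) + (1 - q^m), division by 1 - q^i
-- turns the first term into a pure monomial.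
1-q^-+-quotient : ∀ m i .{{_ : NonZero i}} →
  1-q^ (m + i) ⊛ 1/[1-q^ i ] ≗ q^ m ⊕ 1-q^ m ⊛ 1/[1-q^ i ]
1-q^-+-quotient m i k = begin
  (1-q^ (m + i) ⊛ 1/[1-q^ i ]) k
    ≡⟨ ⊛-congʳ {1/[1-q^ i ]} (1-q^-+ m i) k ⟩
  ((q^ m ⊛ 1-q^ i ⊕ 1-q^ m) ⊛ 1/[1-q^ i ]) k
    ≡⟨ ⊛-distribʳ-⊕ 1/[1-q^ i ] (q^ m ⊛ 1-q^ i) (1-q^ m) k ⟩
  (q^ m ⊛ 1-q^ i ⊛ 1/[1-q^ i ] ⊕ 1-q^ m ⊛ 1/[1-q^ i ]) k
    ≡⟨ cong (ℤ._+ (1-q^ m ⊛ 1/[1-q^ i ]) k) (trans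
         (⊛-assoc (q^ m) (1-q^ i) 1/[1-q^ i ] k)
         (trans (⊛-congˡ {q^ m} (1/[1-q^]-inverse i) k) (⊛-identityʳ (q^ m) k))) ⟩
  (q^ m ⊕ 1-q^ m ⊛ 1/[1-q^ i ]) k ∎
  where open ≡-Reasoning

-- The Gaussian binomial coefficient of e + d over d.
gaussianProduct : ℕ → ℕ → Series
gaussianProduct e d = ∏ d λ i → 1-q^ (e + i) ⊛ 1/[1-q^ i ]

gaussianProduct-0 : ∀ d → gaussianProduct 0 d ≗ 𝟙
gaussianProduct-0 zero    k = refl
gaussianProduct-0 (suc d) k = trans
  (⊛-cong (gaussianProduct-0 d) (1/[1-q^]-inverse (suc d)) k) (⊛-identityˡ 𝟙 k)

-- Both sides have the numerator (1 - q^(e+1)) ... (1 - q^(e+d+1)) over the same denominators. The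
-- cross-multiplied form avoids dividing by 1 - q^(e+1).
gaussianProduct-suc : ∀ e d →
  gaussianProduct e d ⊛ 1-q^ (e + suc d) ≗ gaussianProduct (suc e) d ⊛ 1-q^ (suc e)
gaussianProduct-suc e zero k = cong (λ j → (𝟙 ⊛ 1-q^ j) k) (ℕ.+-comm e 1)
gaussianProduct-suc e (suc d) = begin
  gaussianProduct e d ⊛ (1-q^ (e + suc d) ⊛ r) ⊛ 1-q^ (e + suc (suc d))
    ≈⟨ ⊛-congʳ {1-q^ (e + suc (suc d))} (x∙yz≈xy∙z (gaussianProduct e d) (1-q^ (e + suc d)) r) ⟩
  gaussianProduct e d ⊛ 1-q^ (e + suc d) ⊛ r ⊛ 1-q^ (e + suc (suc d))
    ≈⟨ ⊛-congʳ {1-q^ (e + suc (suc d))} (⊛-congʳ {r} (gaussianProduct-suc e d)) ⟩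
  gaussianProduct (suc e) d ⊛ 1-q^ (suc e) ⊛ r ⊛ 1-q^ (e + suc (suc d))
    ≡⟨ cong (λ j → gaussianProduct (suc e) d ⊛ 1-q^ (suc e) ⊛ r ⊛ 1-q^ j) (ℕ.+-suc e (suc d)) ⟩
  gaussianProduct (suc e) d ⊛ 1-q^ (suc e) ⊛ r ⊛ p
    ≈⟨ ⊛-assoc (gaussianProduct (suc e) d ⊛ 1-q^ (suc e)) r p ⟩
  gaussianProduct (suc e) d ⊛ 1-q^ (suc e) ⊛ (r ⊛ p)
    ≈⟨ ⊛-congˡ {gaussianProduct (suc e) d ⊛ 1-q^ (suc e)} (⊛-comm r p) ⟩
  gaussianProduct (suc e) d ⊛ 1-q^ (suc e) ⊛ (p ⊛ r)
    ≈⟨ xy∙z≈xz∙y (gaussianProduct (suc e) d) (1-q^ (suc e)) (p ⊛ r) ⟩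
  gaussianProduct (suc e) d ⊛ (p ⊛ r) ⊛ 1-q^ (suc e) ∎
  where
  open ≗-Reasoning
  r = 1/[1-q^ suc d ]
  p = 1-q^ (suc e + suc d)

-- The last factor is split by `1-q^-+-quotient`. In the second term, `gaussianProduct-suc` trades
-- the factor 1 - q^(e+1) for the last numerator of `gaussianProduct e (suc d)`.
gaussianProduct-pascal : ∀ e d →
  gaussianProduct (suc e) (suc d) ≗ q^ (suc e) ⊛ gaussianProduct (suc e) d ⊕ gaussianProduct e (suc d)
gaussianProduct-pascal e d k = begin
  (g ⊛ (1-q^ (suc e + suc d) ⊛ r)) k
    ≡⟨ ⊛-congˡ {g} (1-q^-+-quotient (suc e) (suc d)) k ⟩
  (g ⊛ (q^ (suc e) ⊕ 1-q^ (suc e) ⊛ r)) k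
    ≡⟨ ⊛-distribˡ-⊕ g (q^ (suc e)) (1-q^ (suc e) ⊛ r) k ⟩
  (g ⊛ q^ (suc e) ⊕ g ⊛ (1-q^ (suc e) ⊛ r)) k
    ≡⟨ cong₂ ℤ._+_ (⊛-comm g (q^ (suc e)) k) (trans
         (x∙yz≈xy∙z g (1-q^ (suc e)) r k) (trans
         (⊛-congʳ {r} (λ j → sym (gaussianProduct-suc e d j)) k)
         (⊛-assoc (gaussianProduct e d) (1-q^ (e + suc d)) r k))) ⟩
  (q^ (suc e) ⊛ g ⊕ gaussianProduct e (suc d)) k ∎
  where
  open ≡-Reasoning
  g = gaussianProduct (suc e) d
  r = 1/[1-q^ suc d ]

gaussianBinomial-≤ : ∀ {c d} → d ≤ c → gaussianBinomial c d ≡ gaussianProduct (c ∸ d) d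
gaussianBinomial-≤ {c} {d} d≤c =
  cong (if_then gaussianProduct (c ∸ d) d else 𝟘) (dec-true (d ≤? c) d≤c)

gaussianBinomial-> : ∀ {c d} → c < d → gaussianBinomial c d ≡ 𝟘
gaussianBinomial-> {c} {d} c<d =
  cong (if_then gaussianProduct (c ∸ d) d else 𝟘) (dec-false (d ≤? c) (ℕ.<⇒≱ c<d))

gaussianBinomial-+ : ∀ e d → gaussianBinomial (e + d) d ≡ gaussianProduct e d
gaussianBinomial-+ e d = trans (gaussianBinomial-≤ (ℕ.m≤n+m d e))
  (cong (λ j → gaussianProduct j d) (ℕ.m+n∸n≡m e d))

gaussianBinomial-+-suc : ∀ e d → gaussianBinomial (suc (e + d)) (suc d) ≡ gaussianProduct e (suc d)
gaussianBinomial-+-suc e d = trans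
  (cong (λ c → gaussianBinomial c (suc d)) (sym (ℕ.+-suc e d))) (gaussianBinomial-+ e (suc d))

gaussianBinomial-pascal-+ : ∀ e d →
  gaussianBinomial (suc (e + d)) (suc d) ≗
  q^ e ⊛ gaussianBinomial (e + d) d ⊕ gaussianBinomial (e + d) (suc d)
-- For e = 0 the coefficient of d over d + 1 is zero by convention, and the other two are 1.
gaussianBinomial-pascal-+ zero d k = begin
  gaussianBinomial (suc d) (suc d) k
    ≡⟨ cong-app (gaussianBinomial-+-suc 0 d) k ⟩
  gaussianProduct 0 (suc d) k
    ≡⟨ gaussianProduct-0 (suc d) k ⟩
  𝟙 k
    ≡⟨ gaussianProduct-0 d k ⟨
  gaussianProduct 0 d k
    ≡⟨ cong-app (gaussianBinomial-+ 0 d) k ⟨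
  gaussianBinomial d d k
    ≡⟨ ⊛-identityˡ (gaussianBinomial d d) k ⟨
  (𝟙 ⊛ gaussianBinomial d d) k
    ≡⟨ ℤ.+-identityʳ _ ⟨
  (𝟙 ⊛ gaussianBinomial d d) k ℤ.+ 0ℤ
    ≡⟨ cong (λ g → (𝟙 ⊛ gaussianBinomial d d ⊕ g) k) (gaussianBinomial-> (ℕ.n<1+n d)) ⟨
  (𝟙 ⊛ gaussianBinomial d d ⊕ gaussianBinomial d (suc d)) k ∎
  where open ≡-Reasoning
gaussianBinomial-pascal-+ (suc e) d k = begin
  gaussianBinomial (suc (suc e + d)) (suc d) k
    ≡⟨ cong-app (gaussianBinomial-+-suc (suc e) d) k ⟩
  gaussianProduct (suc e) (suc d) k
    ≡⟨ gaussianProduct-pascal e d k ⟩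
  (q^ (suc e) ⊛ gaussianProduct (suc e) d ⊕ gaussianProduct e (suc d)) k
    ≡⟨ cong₂ (λ f g → (q^ (suc e) ⊛ f ⊕ g) k)
         (gaussianBinomial-+ (suc e) d) (gaussianBinomial-+-suc e d) ⟨
  (q^ (suc e) ⊛ gaussianBinomial (suc e + d) d ⊕ gaussianBinomial (suc e + d) (suc d)) k ∎
  where open ≡-Reasoning

gaussianBinomial-pascal : ∀ m d →
  gaussianBinomial (suc m) (suc d) ≗
  q^ (m ∸ d) ⊛ gaussianBinomial m d ⊕ gaussianBinomial m (suc d)
gaussianBinomial-pascal m d k with ℕ.≤-<-connex d m
... | inj₁ d≤m = subst
  (λ j → gaussianBinomial (suc j) (suc d) k ≡
         (q^ (m ∸ d) ⊛ gaussianBinomial j d ⊕ gaussianBinomial j (suc d)) k)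
  (ℕ.m∸n+n≡m d≤m) (gaussianBinomial-pascal-+ (m ∸ d) d k)
-- All three coefficients vanish here, so the truncation of `m ∸ d` to 0 does no harm.
... | inj₂ m<d = begin
  gaussianBinomial (suc m) (suc d) k
    ≡⟨ cong-app (gaussianBinomial-> (s≤s m<d)) k ⟩
  0ℤ
    ≡⟨ ⊛-zeroʳ (q^ (m ∸ d)) k ⟨
  (q^ (m ∸ d) ⊛ 𝟘) k
    ≡⟨ ℤ.+-identityʳ _ ⟨
  (q^ (m ∸ d) ⊛ 𝟘) k ℤ.+ 0ℤ
    ≡⟨ cong₂ (λ f g → (q^ (m ∸ d) ⊛ f ⊕ g) k)
         (gaussianBinomial-> m<d) (gaussianBinomial-> (ℕ.m<n⇒m<1+n m<d)) ⟨
  (q^ (m ∸ d) ⊛ gaussianBinomial m d ⊕ gaussianBinomial m (suc d)) k ∎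
  where open ≡-Reasoning

-- Counting scattered subwords.

multiplicity : List Letter → List (List Letter) → ℕ
multiplicity v us = length (filter (λ u → ≡-dec _≟ᴸ_ u v) us)

multiplicity-++ : ∀ v us us′ → multiplicity v (us List.++ us′) ≡ multiplicity v us + multiplicity v us′
multiplicity-++ v us us′ = trans
  (cong length (filter-++ (λ u → ≡-dec _≟ᴸ_ u v) us us′)) (length-++ (filter _ us))

multiplicity-map-[] : ∀ x us → multiplicity [] (map (x ∷_) us) ≡ 0
multiplicity-map-[] x []       = refl
multiplicity-map-[] x (u ∷ us) = multiplicity-map-[] x us

multiplicity-map-≡ : ∀ x v us → multiplicity (x ∷ v) (map (x ∷_) us) ≡ multiplicity v us
multiplicity-map-≡ x v [] = refl
-- With a concrete letter `_≟ᴸ_` computes, so only the comparison of the remainders is left.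
multiplicity-map-≡ a v (u ∷ us) with ≡-dec _≟ᴸ_ u v
... | yes _ = cong suc (multiplicity-map-≡ a v us)
... | no  _ = multiplicity-map-≡ a v us
multiplicity-map-≡ b v (u ∷ us) with ≡-dec _≟ᴸ_ u v
... | yes _ = cong suc (multiplicity-map-≡ b v us)
... | no  _ = multiplicity-map-≡ b v us

multiplicity-map-≢ : ∀ {x y} → x ≢ y → ∀ v us → multiplicity (y ∷ v) (map (x ∷_) us) ≡ 0
multiplicity-map-≢         x≢y v []       = refl
multiplicity-map-≢ {a} {a} x≢y v (u ∷ us) = ⊥-elim (x≢y refl)
multiplicity-map-≢ {a} {b} x≢y v (u ∷ us) = multiplicity-map-≢ x≢y v us
multiplicity-map-≢ {b} {a} x≢y v (u ∷ us) = multiplicity-map-≢ x≢y v us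
multiplicity-map-≢ {b} {b} x≢y v (u ∷ us) = ⊥-elim (x≢y refl)

occurrences-∷ : ∀ {n} x (w : Word n) v →
  occurrences (x ∷ w) v ≡
  multiplicity v (map (x ∷_) (scatteredSubwords (toList w))) + occurrences w v
occurrences-∷ x w v = multiplicity-++ v (map (x ∷_) (scatteredSubwords (toList w))) _

occurrences-[] : ∀ {n} (w : Word n) → occurrences w [] ≡ 1
occurrences-[] []      = refl
occurrences-[] (x ∷ w) = trans (occurrences-∷ x w [])
  (cong₂ _+_ (multiplicity-map-[] x (scatteredSubwords (toList w))) (occurrences-[] w))

occurrences-∷-≡ : ∀ {n} x (w : Word n) v →
  occurrences (x ∷ w) (x ∷ v) ≡ occurrences w v + occurrences w (x ∷ v)
occurrences-∷-≡ x w v = trans (occurrences-∷ x w (x ∷ v))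
  (cong (_+ occurrences w (x ∷ v)) (multiplicity-map-≡ x v (scatteredSubwords (toList w))))

occurrences-∷-≢ : ∀ {n x y} → x ≢ y → (w : Word n) → ∀ v →
  occurrences (x ∷ w) (y ∷ v) ≡ occurrences w (y ∷ v)
occurrences-∷-≢ {x = x} {y} x≢y w v = trans (occurrences-∷ x w (y ∷ v))
  (cong (_+ occurrences w (y ∷ v)) (multiplicity-map-≢ x≢y v (scatteredSubwords (toList w))))

occurrences-b : ∀ {n} (w : Word n) → occurrences w (b ∷ []) ≡ ∣ w ∣[ b ]
occurrences-b []      = refl
occurrences-b (a ∷ w) = trans (occurrences-∷-≢ (λ ()) w []) (occurrences-b w)
occurrences-b (b ∷ w) = trans (occurrences-∷-≡ b w [])
  (cong₂ _+_ (occurrences-[] w) (occurrences-b w))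

-- The entries of `bsToRight w` decrease weakly; this is the size of the partition they form.
area : ∀ {n} → Word n → ℕ
area w = sum (bsToRight w)

-- An occurrence of ab is an a together with a later b, so each a contributes its own entry of
-- `bsToRight`.
occurrences-ab : ∀ {n} (w : Word n) → occurrences w ab ≡ area w
occurrences-ab []      = refl
occurrences-ab (a ∷ w) = trans (occurrences-∷-≡ a w (b ∷ []))
  (cong₂ _+_ (occurrences-b w) (occurrences-ab w))
occurrences-ab (b ∷ w) = trans (occurrences-∷-≢ (λ ()) w (b ∷ [])) (occurrences-ab w)

-- Letter counts and areas of concatenations.

∣∣a+∣∣b : ∀ {n} (w : Word n) → ∣ w ∣[ a ] + ∣ w ∣[ b ] ≡ n
∣∣a+∣∣b []      = refl
∣∣a+∣∣b (a ∷ w) = cong suc (∣∣a+∣∣b w)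
∣∣a+∣∣b (b ∷ w) = trans (ℕ.+-suc _ _) (cong suc (∣∣a+∣∣b w))

∣∣b≡n∸∣∣a : ∀ {n} (w : Word n) → ∣ w ∣[ b ] ≡ n ∸ ∣ w ∣[ a ]
∣∣b≡n∸∣∣a w = trans (sym (ℕ.m+n∸m≡n ∣ w ∣[ a ] ∣ w ∣[ b ])) (cong (_∸ ∣ w ∣[ a ]) (∣∣a+∣∣b w))

∣++∣ : ∀ {m k} x (u : Word m) (v : Word k) → ∣ u ++ v ∣[ x ] ≡ ∣ u ∣[ x ] + ∣ v ∣[ x ]
∣++∣ x []      v = refl
∣++∣ a (a ∷ u) v = cong suc (∣++∣ a u v)
∣++∣ a (b ∷ u) v = ∣++∣ a u v
∣++∣ b (a ∷ u) v = ∣++∣ b u v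
∣++∣ b (b ∷ u) v = cong suc (∣++∣ b u v)

length-bsToRight : ∀ {n} (w : Word n) → length (bsToRight w) ≡ ∣ w ∣[ a ]
length-bsToRight []      = refl
length-bsToRight (a ∷ w) = cong suc (length-bsToRight w)
length-bsToRight (b ∷ w) = length-bsToRight w

bsToRight-++ : ∀ {m k} (u : Word m) (v : Word k) →
  bsToRight (u ++ v) ≡ map (_+ ∣ v ∣[ b ]) (bsToRight u) List.++ bsToRight v
bsToRight-++ []      v = refl
bsToRight-++ (a ∷ u) v = cong₂ _∷_ (∣++∣ b u v) (bsToRight-++ u v)
bsToRight-++ (b ∷ u) v = bsToRight-++ u v

-- Every a of `u` also sees all the b's of `v`, whence the product term.
area-++ : ∀ {m k} (u : Word m) (v : Word k) →
  area (u ++ v) ≡ area u + ∣ u ∣[ a ] * ∣ v ∣[ b ] + area v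
area-++ []      v = refl
area-++ (b ∷ u) v = area-++ u v
area-++ (a ∷ u) v = trans (cong₂ _+_ (∣++∣ b u v) (area-++ u v)) (begin
  (B + c) + (area u + A * c + area v) ≡⟨ ℕ.+-assoc (B + c) (area u + A * c) (area v) ⟨
  (B + c) + (area u + A * c) + area v ≡⟨ cong (_+ area v) (ℕ+-interchange B c (area u) (A * c)) ⟩
  (B + area u) + (c + A * c) + area v ∎)
  where
  open ≡-Reasoning
  A = ∣ u ∣[ a ]
  B = ∣ u ∣[ b ]
  c = ∣ v ∣[ b ]

-- Recovering words and suffixes from their entries.

head-bsToRight-≤ : ∀ {n r rs} (w : Word n) → bsToRight w ≡ r ∷ rs → r ≤ ∣ w ∣[ b ]
head-bsToRight-≤ (a ∷ w) refl = ℕ.≤-refl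
head-bsToRight-≤ (b ∷ w) p    = ℕ.m≤n⇒m≤1+n (head-bsToRight-≤ w p)

-- Leading b's leave no entry, so the number of b's has to be given. It forces the first letters to
-- agree: after an initial a the first entry equals the total number of b's, after an initial b it
-- is smaller.
bsToRight-injective : ∀ {m n} (u : Word m) (v : Word n) →
  ∣ u ∣[ b ] ≡ ∣ v ∣[ b ] → bsToRight u ≡ bsToRight v → toList u ≡ toList v
bsToRight-injective []      []      _  _ = refl
bsToRight-injective []      (b ∷ v) () _
bsToRight-injective (b ∷ u) []      () _
bsToRight-injective (a ∷ u) (a ∷ v) _  p =
  cong (a ∷_) (bsToRight-injective u v (List.∷-injectiveˡ p) (List.∷-injectiveʳ p))
bsToRight-injective (b ∷ u) (b ∷ v) q  p =
  cong (b ∷_) (bsToRight-injective u v (ℕ.suc-injective q) p)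
bsToRight-injective (a ∷ u) (b ∷ v) q  p =
  ⊥-elim (ℕ.<⇒≢ (s≤s (head-bsToRight-≤ v (sym p))) q)
bsToRight-injective (b ∷ u) (a ∷ v) q  p =
  ⊥-elim (ℕ.<⇒≢ (s≤s (head-bsToRight-≤ u p)) (sym q))

-- Suffixes cut off just before an a (or empty) are the ones determined by a
-- tail: the tail does not see the b's that precede its last recorded a.
data Anchored : ∀ {n} → Word n → Set where
  []  : Anchored []
  a∷_ : ∀ {n} (w : Word n) → Anchored (a ∷ w)

-- Being indexed by the word, a match on `split` replaces the word by `x ++ v` throughout the goal.
data Split (j : ℕ) : ∀ {n} → Word n → Set where
  split : ∀ {m k} (x : Word m) {v : Word k} →
          Anchored v → ∣ v ∣[ a ] ≡ j → Split j (x ++ v)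

Split-∷ : ∀ {j n} {w : Word n} x → Split j w → Split j (x ∷ w)
Split-∷ x (split u v p) = split (x ∷ u) v p

splitBeforeLast : ∀ {n} j (w : Word n) → j ≤ ∣ w ∣[ a ] → Split j w
splitBeforeLast zero []      _ = split [] [] refl
splitBeforeLast j    (b ∷ w) p = Split-∷ b (splitBeforeLast j w p)
splitBeforeLast j    (a ∷ w) p with j ≤? ∣ w ∣[ a ]
... | yes j≤ = Split-∷ a (splitBeforeLast j w j≤)
-- Fewer than `j` a's follow, yet at least `j` remain with this one: it is the `j`-th a from the
-- right. For `j` = 0 this never happens and the cut is at the end.
... | no  j≰ = split [] (a∷ w) (ℕ.≤-antisym (ℕ.≰⇒> j≰) p)

-- Letters of `u` are stripped until `rs` is used up and an a is reached. Its entry and the first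
-- entry of `v` then give equal numbers of b's after these two a's, as `bsToRight-injective`
-- requires.
anchored-suffix : ∀ {m n} {v : Word n} → Anchored v → (u : Word m) → ∀ rs →
  bsToRight u ≡ rs List.++ bsToRight v → ∃[ xs ] toList u ≡ xs List.++ toList v
anchored-suffix []      u       rs       p = toList u , sym (List.++-identityʳ _)
anchored-suffix (a∷ v)  []      []       ()
anchored-suffix (a∷ v)  []      (_ ∷ _)  ()
anchored-suffix (a∷ v)  (b ∷ u) rs       p with anchored-suffix (a∷ v) u rs p
... | xs , q = b ∷ xs , cong (b ∷_) q
anchored-suffix (a∷ v)  (a ∷ u) []       p =
  [] , cong (a ∷_) (bsToRight-injective u v (List.∷-injectiveˡ p) (List.∷-injectiveʳ p))
anchored-suffix (a∷ v)  (a ∷ u) (r ∷ rs) p with anchored-suffix (a∷ v) u rs (List.∷-injectiveʳ p)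
... | xs , q = a ∷ xs , cong (a ∷_) q

toList-suffix : ∀ {A : Set} {m n} (u : Vec A (m + n)) (v : Vec A n) xs →
  toList u ≡ xs List.++ toList v → ∃[ y ] u ≡ y ++ v
toList-suffix {m = m} {n} u v xs p = align length-xs u p
  where
  open ≡-Reasoning
  length-xs : m ≡ length xs
  length-xs = ℕ.+-cancelʳ-≡ n m (length xs) (begin
    m + n                         ≡⟨ Vec.length-toList u ⟨
    length (toList u)             ≡⟨ cong length p ⟩
    length (xs List.++ toList v)  ≡⟨ length-++ xs ⟩
    length xs + length (toList v) ≡⟨ cong (λ l → length xs + l) (Vec.length-toList v) ⟩
    length xs + n                 ∎)

  -- The length is generalised so that its equation with `length xs` can be matched by `refl`.
  align : ∀ {m} → m ≡ length xs → (u : Vec _ (m + n)) → toList u ≡ xs List.++ toList v →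
          ∃[ y ] u ≡ y ++ v
  align refl u p = fromList xs , (begin
    u               ≡⟨ Vec.cast-is-id refl u ⟨
    Vec.cast refl u ≡⟨ Vec.toList-injective refl u (fromList xs ++ v) (begin
      toList u                             ≡⟨ p ⟩
      xs List.++ toList v                  ≡⟨ cong (List._++ toList v) (Vec.toList∘fromList xs) ⟨
      toList (fromList xs) List.++ toList v ≡⟨ Vec.toList-++ (fromList xs) v ⟨
      toList (fromList xs ++ v)            ∎) ⟩
    fromList xs ++ v ∎)

-- Tail, last entry and residual area of a split word.

take-length-++ : ∀ {A : Set} (xs ys : List A) → take (length xs) (xs List.++ ys) ≡ xs
take-length-++ []       ys = refl
take-length-++ (x ∷ xs) ys = cong (x ∷_) (take-length-++ xs ys)

last-∷ʳ : ∀ {A : Set} (xs : List A) x → last (xs List.∷ʳ x) ≡ just x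
last-∷ʳ []           x = refl
last-∷ʳ (_ ∷ [])     x = refl
last-∷ʳ (_ ∷ y ∷ xs) x = last-∷ʳ (y ∷ xs) x

take-reverse⇒suffix : ∀ {A : Set} j (xs ys : List A) →
  take j (reverse xs) ≡ reverse ys → xs ≡ reverse (drop j (reverse xs)) List.++ ys
take-reverse⇒suffix j xs ys p = begin
  xs
    ≡⟨ List.reverse-involutive xs ⟨
  reverse (reverse xs)
    ≡⟨ cong reverse (List.take++drop≡id j (reverse xs)) ⟨
  reverse (take j (reverse xs) List.++ drop j (reverse xs))
    ≡⟨ List.reverse-++ (take j (reverse xs)) (drop j (reverse xs)) ⟩
  reverse (drop j (reverse xs)) List.++ reverse (take j (reverse xs))
    ≡⟨ cong (reverse (drop j (reverse xs)) List.++_) (trans (cong reverse p) (List.reverse-involutive ys)) ⟩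
  reverse (drop j (reverse xs)) List.++ ys ∎
  where open ≡-Reasoning

tail-++ : ∀ s {m k} (x : Word m) (v : Word k) →
  tailLength s (x ++ v) ≡ ∣ v ∣[ a ] → tail s (x ++ v) ≡ reverse (bsToRight v)
tail-++ s x v p = begin
  take (tailLength s (x ++ v)) (reverse (bsToRight (x ++ v)))
    ≡⟨ cong₂ take (trans p (sym (trans (List.length-reverse (bsToRight v)) (length-bsToRight v))))
                  (trans (cong reverse (bsToRight-++ x v)) (List.reverse-++ rs (bsToRight v))) ⟩
  take (length (reverse (bsToRight v))) (reverse (bsToRight v) List.++ reverse rs)
    ≡⟨ take-length-++ (reverse (bsToRight v)) (reverse rs) ⟩
  reverse (bsToRight v) ∎
  where
  open ≡-Reasoning
  rs = map (_+ ∣ v ∣[ b ]) (bsToRight x)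

tail-≡⇒suffix : ∀ s {m k} {v : Word k} → Anchored v → (u : Word (m + k)) →
  tail s u ≡ reverse (bsToRight v) → ∃[ y ] u ≡ y ++ v
tail-≡⇒suffix s {v = v} av u p
  with anchored-suffix av u _ (take-reverse⇒suffix (tailLength s u) (bsToRight u) (bsToRight v) p)
... | xs , q = toList-suffix u v xs q

-- The last entry of the tail belongs to the leading a of `v`, which sees every b of `v`. For empty
-- `v` the default 0 is the right count as well.
θ-++ : ∀ s {m k} (x : Word m) {v : Word k} → Anchored v →
  tailLength s (x ++ v) ≡ ∣ v ∣[ a ] → θ s (x ++ v) ≡ ∣ v ∣[ b ]
θ-++ s x {v} av p = trans (cong (fromMaybe 0 ∘ last) (tail-++ s x v p)) (lemma av)
  where
  lemma : ∀ {k} {v : Word k} → Anchored v → fromMaybe 0 (last (reverse (bsToRight v))) ≡ ∣ v ∣[ b ]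
  lemma []     = refl
  lemma (a∷ v) = cong (fromMaybe 0) (trans
    (cong last (unfold-reverse ∣ v ∣[ b ] (bsToRight v))) (last-∷ʳ (reverse (bsToRight v)) _))

∣++∣∸tailLength : ∀ s {m k} (x : Word m) (v : Word k) →
  tailLength s (x ++ v) ≡ ∣ v ∣[ a ] → ∣ x ++ v ∣[ a ] ∸ tailLength s (x ++ v) ≡ ∣ x ∣[ a ]
∣++∣∸tailLength s x v p = trans (cong₂ _∸_ (∣++∣ a x v) p) (ℕ.m+n∸n≡m ∣ x ∣[ a ] ∣ v ∣[ a ])

-- The two terms subtracted in the residual area are exactly the product term and the area of `v` in
-- `area-++`.
residualArea-++ : ∀ s {m k} (x : Word m) {v : Word k} → Anchored v →
  tailLength s (x ++ v) ≡ ∣ v ∣[ a ] → residualArea s (x ++ v) ≡ + area x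
residualArea-++ s x {v} av p = begin
  + occurrences (x ++ v) ab ℤ.- + ((∣ x ++ v ∣[ a ] ∸ tailLength s (x ++ v)) * θ s (x ++ v))
    ℤ.- + sum (tail s (x ++ v))
    ≡⟨ cong₂ ℤ._-_ (cong₂ (λ i j → + i ℤ.- + j)
         (trans (occurrences-ab (x ++ v)) (area-++ x v))
         (cong₂ _*_ (∣++∣∸tailLength s x v p) (θ-++ s x av p)))
         (cong +_ (trans (cong sum (tail-++ s x v p)) (sum-↭ (↭-reverse (bsToRight v))))) ⟩
  + (area x + d + area v) ℤ.- + d ℤ.- + area v
    ≡⟨ cong (λ z → z ℤ.- + d ℤ.- + area v)
         (trans (ℤ.pos-+ (area x + d) (area v)) (cong (ℤ._+ + area v) (ℤ.pos-+ (area x) d))) ⟩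
  + area x ℤ.+ + d ℤ.+ + area v ℤ.- + d ℤ.- + area v
    ≡⟨ lemma (+ area x) (+ d) (+ area v) ⟩
  + area x ∎
  where
  open ≡-Reasoning
  d = ∣ x ∣[ a ] * ∣ v ∣[ b ]
  lemma : ∀ i j k → i ℤ.+ j ℤ.+ k ℤ.- j ℤ.- k ≡ i
  lemma = solve-∀

-- Bijections and cardinalities.

-- Since the predicates are irrelevant, pairs are equal once their first components are; both
-- inverse laws then come down to equations in `A` and `B`.
Σ-↔ : ∀ {A B : Set} {P : A → Set} {Q : B → Set} (f : A → B) →
  Injective _≡_ _≡_ f → Irrelevant P → Irrelevant Q →
  (∀ x → P x → Q (f x)) → (∀ y → Q y → ∃[ x ] y ≡ f x × P x) → Σ A P ↔ Σ B Q
Σ-↔ {P = P} {Q} f f-inj P-irr Q-irr P⇒Q Q⇒P = mk↔ₛ′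
  (λ (x , p) → f x , P⇒Q x p)
  (λ (y , q) → let x , _ , p = Q⇒P y q in x , p)
  (λ (y , q) → let x , y≡fx , p = Q⇒P y q in Σ-≡ Q-irr (sym y≡fx))
  (λ (x , p) → let x′ , fx≡fx′ , p′ = Q⇒P (f x) (P⇒Q x p) in Σ-≡ P-irr (sym (f-inj fx≡fx′)))
  where
  Σ-≡ : ∀ {A : Set} {P : A → Set} → Irrelevant P → ∀ {x y p q} → x ≡ y → _≡_ {A = Σ A P} (x , p) (y , q)
  Σ-≡ irr refl = cong (_ ,_) (irr _ _)

≡×≡-irrelevant : ∀ {A B : Set} {x x′ : A} {y y′ : B} (p q : x ≡ x′ × y ≡ y′) → p ≡ q
≡×≡-irrelevant (p , q) (p′ , q′) = cong₂ _,_ (≡-irrelevant p p′) (≡-irrelevant q q′)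

-- Coefficients are integers. Carrying the natural number along lets q-Pascal's rule be used in ℤ,
-- with nonnegativity coming out of the count.
HasCardinalityℤ : Set → ℤ → Set
HasCardinalityℤ X z = ∃[ k ] (HasCardinality X k × + k ≡ z)

↔-HasCardinality : ∀ {X Y z} → X ↔ Y → HasCardinalityℤ Y z → HasCardinalityℤ X z
↔-HasCardinality X↔Y (k , Y↔k , k≡z) = k , Y↔k ↔-∘ X↔Y , k≡z

⊎-HasCardinality : ∀ {X Y x y} → HasCardinalityℤ X x → HasCardinalityℤ Y y → HasCardinalityℤ (X ⊎ Y) (x ℤ.+ y)
⊎-HasCardinality (k , X↔k , k≡x) (l , Y↔l , l≡y) =
  k + l , ↔-sym +↔⊎ ↔-∘ (X↔k ⊎-cong Y↔l) , trans (ℤ.pos-+ k l) (cong₂ ℤ._+_ k≡x l≡y)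

empty-HasCardinality : ∀ {X z} → ¬ X → z ≡ 0ℤ → HasCardinalityℤ X z
empty-HasCardinality ¬X z≡0 = 0 , mk↔ₛ′ (⊥-elim ∘ ¬X) (λ ()) (λ ()) (⊥-elim ∘ ¬X) , sym z≡0

-- Counting words by length, number of a's and area.

WordsOfArea : ℕ → ℕ → ℕ → Set
WordsOfArea m d k = Σ (Word m) λ y → ∣ y ∣[ a ] ≡ d × area y ≡ k

-- The summands collect the words beginning with a and with b: an initial a adds `∣ y ∣[ b ]` to the
-- area, an initial b adds nothing.
∷-WordsOfArea : ∀ m d k → WordsOfArea (suc m) (suc d) k ↔
  ((Σ (Word m) λ y → ∣ y ∣[ a ] ≡ d × ∣ y ∣[ b ] + area y ≡ k) ⊎ WordsOfArea m (suc d) k)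
∷-WordsOfArea m d k = mk↔ₛ′
  (λ { (a ∷ y , refl , q) → inj₁ (y , refl , q)
     ; (b ∷ y , p , q)    → inj₂ (y , p , q) })
  (λ { (inj₁ (y , refl , q)) → a ∷ y , refl , q
     ; (inj₂ (y , p , q))    → b ∷ y , p , q })
  (λ { (inj₁ (y , refl , q)) → refl
     ; (inj₂ (y , p , q))    → refl })
  (λ { (a ∷ y , refl , q) → refl
     ; (b ∷ y , p , q)    → refl })

b∷-WordsOfArea : ∀ m k → WordsOfArea (suc m) 0 k ↔ WordsOfArea m 0 k
b∷-WordsOfArea m k = mk↔ₛ′
  (λ { (b ∷ y , p) → y , p }) (λ { (y , p) → b ∷ y , p })
  (λ _ → refl) (λ { (b ∷ y , p) → refl })

-- The b's that follow an initial a shift the area by m ∸ d.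
shifted-WordsOfArea : ∀ m d k → m ∸ d ≤ k →
  (Σ (Word m) λ y → ∣ y ∣[ a ] ≡ d × ∣ y ∣[ b ] + area y ≡ k) ↔ WordsOfArea m d (k ∸ (m ∸ d))
shifted-WordsOfArea m d k e≤k = Σ-↔ id id
  ≡×≡-irrelevant ≡×≡-irrelevant
  (λ { y (refl , q) → refl , trans (sym (ℕ.m+n∸m≡n ∣ y ∣[ b ] (area y))) (cong₂ _∸_ q (∣∣b≡n∸∣∣a y)) })
  (λ { y (refl , q) → y , refl , refl ,
         trans (cong₂ _+_ (∣∣b≡n∸∣∣a y) q) (ℕ.m+[n∸m]≡n e≤k) })

card-WordsOfArea : ∀ m d k → HasCardinalityℤ (WordsOfArea m d k) (gaussianBinomial m d k)
card-WordsOfArea zero zero zero = 1 , mk↔ₛ′ (λ _ → zero) (λ _ → [] , refl , refl)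
  (λ { zero → refl }) (λ { ([] , refl , refl) → refl }) , refl
card-WordsOfArea zero zero    (suc k) = empty-HasCardinality (λ { ([] , _ , ()) }) refl
card-WordsOfArea zero (suc d) k       = empty-HasCardinality (λ { ([] , () , _) }) refl
-- For `d` = 0 the product is empty, so both Gaussian binomials compute to `𝟙`.
card-WordsOfArea (suc m) zero k = ↔-HasCardinality (b∷-WordsOfArea m k) (card-WordsOfArea m zero k)
card-WordsOfArea (suc m) (suc d) k = subst (HasCardinalityℤ _) (sym (gaussianBinomial-pascal m d k))
  (↔-HasCardinality (∷-WordsOfArea m d k)
    (⊎-HasCardinality (a∷-card (ℕ.≤-<-connex (m ∸ d) k)) (card-WordsOfArea m (suc d) k)))
  where
  a∷-card : m ∸ d ≤ k ⊎ k < m ∸ d → HasCardinalityℤ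
    (Σ (Word m) λ y → ∣ y ∣[ a ] ≡ d × ∣ y ∣[ b ] + area y ≡ k) ((q^ (m ∸ d) ⊛ gaussianBinomial m d) k)
  a∷-card (inj₁ e≤k) = subst (HasCardinalityℤ _) (sym (q^-⊛-≤ (gaussianBinomial m d) e≤k))
    (↔-HasCardinality (shifted-WordsOfArea m d k e≤k) (card-WordsOfArea m d (k ∸ (m ∸ d))))
  -- The initial a is followed by exactly `m ∸ d` b's, so no such word has a smaller area.
  a∷-card (inj₂ k<e) = empty-HasCardinality
    (λ { (y , refl , q) → ℕ.<⇒≱ k<e (subst₂ _≤_ (∣∣b≡n∸∣∣a y) q (ℕ.m≤m+n ∣ y ∣[ b ] (area y))) })
    (q^-⊛-> (gaussianBinomial m d) k<e)

-- The class of a split word.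

class-↔ : ∀ s {m k} (x : Word m) {v : Word k} → Anchored v → tailLength s (x ++ v) ≡ ∣ v ∣[ a ] →
  WordsOfArea m ∣ x ∣[ a ] (area x) ↔ Class s (x ++ v)
class-↔ s x {v} av p = Σ-↔ (_++ v) (Vec.++-injectiveˡ _ _)
  ≡×≡-irrelevant
  (λ (p , q) (p′ , q′) → cong₂ _,_ (≡×≡-irrelevant p p′) (≡-irrelevant q q′))
  to from
  where
  -- The tail length depends only on `s` and the number of a's, so it is constant on the class.
  tailLength-≡ : ∀ u → ∣ u ∣[ a ] ≡ ∣ x ++ v ∣[ a ] → tailLength s u ≡ ∣ v ∣[ a ]
  tailLength-≡ u q = trans (cong (s ⊓_) q) p

  occurrences-++ : ∀ {m} (y : Word m) →
    occurrences (y ++ v) ab ≡ area y + (∣ y ∣[ a ] * ∣ v ∣[ b ] + area v)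
  occurrences-++ y = trans (occurrences-ab (y ++ v)) (trans (area-++ y v) (ℕ.+-assoc (area y) _ _))

  to : ∀ y → ∣ y ∣[ a ] ≡ ∣ x ∣[ a ] × area y ≡ area x → (y ++ v) ≈[ s ] (x ++ v)
  to y (q , r) = (∣a∣-≡ ,
    trans (occurrences-++ y) (trans
      (cong₂ (λ i j → i + (j * ∣ v ∣[ b ] + area v)) r q) (sym (occurrences-++ x)))) ,
    trans (tail-++ s y v (tailLength-≡ (y ++ v) ∣a∣-≡)) (sym (tail-++ s x v p))
    where
    ∣a∣-≡ = trans (∣++∣ a y v) (trans (cong (_+ ∣ v ∣[ a ]) q) (sym (∣++∣ a x v)))

  from : ∀ u → u ≈[ s ] (x ++ v) →
    ∃[ y ] (u ≡ y ++ v × ∣ y ∣[ a ] ≡ ∣ x ∣[ a ] × area y ≡ area x)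
  from u ((q , r) , t) with tail-≡⇒suffix s av u (trans t (tail-++ s x v p))
  -- As `y` and `x` have equally many a's, the contributions of `v` to the two areas agree and
  -- cancel.
  ... | y , refl = y , refl , ∣a∣-≡ , ℕ.+-cancelʳ-≡ _ _ _ (begin
    area y + (∣ x ∣[ a ] * ∣ v ∣[ b ] + area v)
      ≡⟨ cong (λ j → area y + (j * ∣ v ∣[ b ] + area v)) ∣a∣-≡ ⟨
    area y + (∣ y ∣[ a ] * ∣ v ∣[ b ] + area v)
      ≡⟨ occurrences-++ y ⟨
    occurrences (y ++ v) ab
      ≡⟨ r ⟩
    occurrences (x ++ v) ab
      ≡⟨ occurrences-++ x ⟩
    area x + (∣ x ∣[ a ] * ∣ v ∣[ b ] + area v) ∎)
    where
    open ≡-Reasoning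
    ∣a∣-≡ : ∣ y ∣[ a ] ≡ ∣ x ∣[ a ]
    ∣a∣-≡ = ℕ.+-cancelʳ-≡ ∣ v ∣[ a ] ∣ y ∣[ a ] ∣ x ∣[ a ]
      (trans (sym (∣++∣ a y v)) (trans q (∣++∣ a x v)))

theorem3 : (s n : ℕ) (w : Word n) →
    ∃[ k ] (HasCardinality (Class s w) k ×
    + k ≡ [q^ residualArea s w ]
    gaussianBinomial
    ((∣ w ∣[ a ] ∸ tailLength s w) + (∣ w ∣[ b ] ∸ θ s w))
    (∣ w ∣[ a ] ∸ tailLength s w))
theorem3 s n w = card (splitBeforeLast (tailLength s w) w (ℕ.m⊓n≤n s ∣ w ∣[ a ]))
  where
  -- The word and its length are generalised so that matching on `split` can set them to `x ++ v`
  -- and its length.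
  card : ∀ {n} {w : Word n} → Split (tailLength s w) w → HasCardinalityℤ (Class s w)
    ([q^ residualArea s w ] gaussianBinomial
      ((∣ w ∣[ a ] ∸ tailLength s w) + (∣ w ∣[ b ] ∸ θ s w)) (∣ w ∣[ a ] ∸ tailLength s w))
  card (split x {v} av p) = subst (HasCardinalityℤ _)
    -- The exponent becomes `area x`, the lower index `∣ x ∣[ a ]`, and the upper index the length
    -- of `x`.
    (sym (cong₂ [q^_]_ (residualArea-++ s x av (sym p))
      (cong₂ gaussianBinomial
        (trans (cong₂ _+_ ∣a∣-≡ ∣b∣-≡) (∣∣a+∣∣b x)) ∣a∣-≡)))
    (↔-HasCardinality (↔-sym (class-↔ s x av (sym p))) (card-WordsOfArea _ _ _))
    where
    ∣a∣-≡ = ∣++∣∸tailLength s x v (sym p)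
    ∣b∣-≡ = trans (cong₂ _∸_ (∣++∣ b x v) (θ-++ s x av (sym p))) (ℕ.m+n∸n≡m ∣ x ∣[ b ] ∣ v ∣[ b ])
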